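{- Let $n\ge k>a\ge 0$ be integers. If $n\ge \left(a+\frac52\right)(k-a+2)-6$ and $k-2\ge a\ge k/2$, then $B(J(n,k,a))= a+2$.
   Context: All graphs are finite, undirected, without loops or multiple edges. In a zero forcing process, the vertices of a graph are initially colored black or white; whenever there is a black vertex adjacent to exactly one white vertex, that white vertex is forced to become black, and this is repeated as long as possible. An initial set of black vertices is a zero forcing set if eventually all vertices of the graph become black; otherwise it is a failed zero forcing set, and its complement (the initial set of white vertices) is called a zero blocking set. The zero blocking number $B(G)$ of $G$ is the minimum size of a zero blocking set of $G$. Let $[n]=\{1,2,\ldots,n\}$. For integers $n\ge k>a\ge 0$, the generalized Johnson graph $J(n,k,a)$ is the graph whose vertices are the $k$-subsets of $[n]$, where two vertices $A$ and $B$ are adjacent if and only if $|A\cap B|=a$. -}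

module Defs where

open import Data.Bool using (Bool; true; false; not)
open import Data.Fin using (Fin)
open import Data.Fin.Properties using (0↔⊥; 1↔⊤; +↔⊎)
open import Data.Fin.Subset using (Subset; inside; outside; _∩_; ∣_∣)
open import Data.Fin.Subset.Properties using (∩-comm; ∩-idem)
open import Data.Nat using (ℕ; zero; suc; _+_; _≤_; _<_; _≟_)
open import Data.Nat.Properties using (suc-injective; <-irrefl; ≡-irrelevant)
open import Data.Product using (Σ; ∃-syntax; _×_; _,_; proj₁; proj₂)
open import Data.Sum using (_⊎_; inj₁; inj₂)
open import Data.Sum.Function.Propositional using (_⊎-↔_)
open import Data.Vec using ([]; _∷_; tabulate)
open import Function using (_∘_)
open import Function.Bundles using (_↔_; mk↔ₛ′; Inverse)
open import Function.Properties.Inverse using (↔-sym; ↔-trans)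
open import Relation.Binary using (Symmetric; Irreflexive; Decidable)
open import Relation.Binary.Construct.Closure.ReflexiveTransitive using (Star)
open import Relation.Binary.PropositionalEquality
  using (_≡_; refl; sym; trans; cong; _≢_)
open import Relation.Nullary using (¬_)

record Graph : Set₁ where
  infix 4 _~_
  field
    Vertex : Set
    order  : ℕ
    index  : Vertex ↔ Fin order
    _~_    : Vertex → Vertex → Set
    _~?_   : Decidable _~_
    ~-sym    : Symmetric _~_
    ~-irrefl : Irreflexive _≡_ _~_

module ZeroForcing (G : Graph) where
  open Graph G

  VertexSet : Set
  VertexSet = Vertex → Bool

  infix 4 _∈_ _∉_

  _∈_ : Vertex → VertexSet → Set
  v ∈ S = S v ≡ true

  _∉_ : Vertex → VertexSet → Set
  v ∉ S = S v ≡ false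

  complement : VertexSet → VertexSet
  complement S = not ∘ S

  size : VertexSet → ℕ
  size S = ∣ tabulate (S ∘ Inverse.from index) ∣

  -- A colouring is represented by its set of black vertices.
  -- S ⟶ T: a black vertex u whose only white neighbour is v forces v,
  -- and nothing else changes.
  infix 4 _⟶_

  record _⟶_ (S T : VertexSet) : Set where
    field
      u v       : Vertex
      u-black   : u ∈ S
      u~v       : u ~ v
      v-white   : v ∉ S
      only      : ∀ w → u ~ w → w ∉ S → w ≡ v
      v-forced  : v ∈ T
      unchanged : ∀ w → w ≢ v → T w ≡ S w

  -- The process is confluent, so it does not matter in which order (or
  -- whether simultaneously) the available forces are carried out.
  ZeroForcingSet : VertexSet → Set
  ZeroForcingSet S = ∃[ T ] Star _⟶_ S T × (∀ v → v ∈ T)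

  FailedZeroForcingSet : VertexSet → Set
  FailedZeroForcingSet S = ¬ ZeroForcingSet S

  ZeroBlockingSet : VertexSet → Set
  ZeroBlockingSet W = FailedZeroForcingSet (complement W)

-- B[ G ]≡ b: the minimum size of a zero blocking set of G exists and is b.
-- (A graph without vertices has no zero blocking set.)
B[_]≡_ : Graph → ℕ → Set
B[ G ]≡ b =
    (∃[ W ] ZeroBlockingSet W × size W ≡ b)
  × (∀ W → ZeroBlockingSet W → b ≤ size W)
  where open ZeroForcing G

KSubset : ℕ → ℕ → Set
KSubset n k = Σ (Subset n) λ A → ∣ A ∣ ≡ k

KSubset-≡ : ∀ {n k} {A B : KSubset n k} → proj₁ A ≡ proj₁ B → A ≡ B
KSubset-≡ {A = A , p} {.A , q} refl = cong (A ,_) (≡-irrelevant p q)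

KSubset-zero : ∀ n → KSubset (suc n) zero ↔ KSubset n zero
KSubset-zero n = mk↔ₛ′
  (λ { (outside ∷ A , p) → A , p })
  (λ { (A , p) → outside ∷ A , p })
  (λ _ → refl)
  (λ { (outside ∷ A , p) → refl })

KSubset-suc : ∀ n k → KSubset (suc n) (suc k) ↔ (KSubset n k ⊎ KSubset n (suc k))
KSubset-suc n k = mk↔ₛ′
  (λ { (inside ∷ A , p) → inj₁ (A , suc-injective p)
     ; (outside ∷ A , p) → inj₂ (A , p) })
  (λ { (inj₁ (A , p)) → inside ∷ A , cong suc p
     ; (inj₂ (A , p)) → outside ∷ A , p })
  (λ { (inj₁ _) → cong inj₁ (KSubset-≡ refl) ; (inj₂ _) → refl })
  (λ { (inside ∷ A , p) → KSubset-≡ refl ; (outside ∷ A , p) → refl })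

KSubset-finite : ∀ n k → ∃[ m ] (KSubset n k ↔ Fin m)
KSubset-finite zero zero = 1 , ↔-trans
  (mk↔ₛ′ _ (λ _ → [] , refl) (λ _ → refl) (λ { ([] , p) → KSubset-≡ refl }))
  (↔-sym 1↔⊤)
KSubset-finite zero (suc k) = 0 , ↔-trans
  (mk↔ₛ′ (λ { ([] , ()) }) (λ ()) (λ ()) (λ { ([] , ()) }))
  (↔-sym 0↔⊥)
KSubset-finite (suc n) zero with KSubset-finite n zero
... | m , f = m , ↔-trans (KSubset-zero n) f
KSubset-finite (suc n) (suc k) with KSubset-finite n k | KSubset-finite n (suc k)
... | l , f | m , g =
  l + m , ↔-trans (KSubset-suc n k) (↔-trans (f ⊎-↔ g) (↔-sym +↔⊎))

-- The generalized Johnson graph J(n,k,a); a < k makes it loopless.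
J : (n k a : ℕ) → a < k → Graph
J n k a a<k = record
  { Vertex   = KSubset n k
  ; order    = proj₁ (KSubset-finite n k)
  ; index    = proj₂ (KSubset-finite n k)
  ; _~_      = λ A B → ∣ proj₁ A ∩ proj₁ B ∣ ≡ a
  ; _~?_     = λ A B → ∣ proj₁ A ∩ proj₁ B ∣ ≟ a
  ; ~-sym    = λ {A} {B} p → trans (cong ∣_∣ (∩-comm (proj₁ B) (proj₁ A))) p
  ; ~-irrefl = λ { {A , ∣A∣≡k} refl p →
      <-irrefl (trans (sym p) (trans (cong ∣_∣ (∩-idem A)) ∣A∣≡k)) a<k }
  }

{-# OPTIONS --safe #-}
-- Call a nonempty set F of vertices a fort when no vertex has exactly one
-- neighbour in F: forts stay white, so they are zero blocking sets.  For S ⊆ M with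
-- ∣M∣ = k + 1 and ∣S∣ = a + 2, the a + 2 sets M - s with s ∈ S form a fort.
--
-- Conversely let W have at most a + 1 members, let A ∈ W and put d = k - a.  Choose
-- a set T of a elements of A that contains an element of A ─ X for every other
-- X ∈ W, and forbid min(d + 1, ∣X ─ A∣) elements of each X ─ A.  At most
-- k + a(d + 1) elements are forbidden or in A, so some d others form a set R.
-- Then T ∪ R meets A in a elements and every other X ∈ W in fewer than a, so A is
-- its only white neighbour.  There is room for R because, as d ≥ 2, the bound on n
-- gives k + a(d + 1) + d ≤ n, with equality possible for d = 2.
module Submission where

open import Defs
open import Data.Bool using (Bool; true; false; not; _∨_)
import Data.Bool as Bool
open import Data.Bool.Properties using (∨-zeroʳ; ∨-identityʳ)
open import Data.Fin using (Fin; zero; suc)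
open import Data.Fin.Subset hiding (⊥; ⊤)
  renaming (_∈_ to _∈ₛ_; _∉_ to _∉ₛ_)
import Data.Fin.Subset as Subset
open import Data.Fin.Subset.Properties
import Data.Fin.Properties as Fin
open import Data.List using (List; []; _∷_; length; map)
open import Data.List.Membership.Propositional using () renaming (_∈_ to _∈ₗ_)
open import Data.List.Membership.Propositional.Properties using (∈-map⁺; ∈-map⁻)
import Data.List.Membership.DecPropositional as DecMembership
open import Data.List.Properties using (length-map)
open import Data.List.Relation.Unary.Any using (here; there)
open import Data.Nat using (ℕ; zero; suc; _+_; _*_; _∸_; _≤_; _<_; z≤n; s≤s; s≤s⁻¹; _≤?_)
open import Data.Nat.Properties
open import Data.Nat.Solver using (module +-*-Solver)
open import Data.Product using (Σ; ∃-syntax; _×_; _,_; proj₁; proj₂)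
open import Data.Sum using (_⊎_; inj₁; inj₂; [_,_]′)
open import Data.Vec using ([]; _∷_; tabulate; here; there)
open import Data.Vec.Properties using (lookup⇒[]=; []=⇒lookup; lookup∘tabulate; ≡-dec)
open import Function using (_∘_)
open import Function.Bundles using (Inverse)
open import Function.Properties.Inverse using (Inverse⇒Injection)
open import Relation.Binary using (DecidableEquality)
open import Relation.Binary.Construct.Closure.ReflexiveTransitive using (Star; ε; _◅_)
open import Relation.Binary.PropositionalEquality
  using (_≡_; refl; sym; trans; cong; cong₂; subst; _≢_)
open import Relation.Nullary using (¬_; yes; no; does; contradiction)
open import Relation.Nullary.Decidable using (dec-true; dec-false; toSum; via-injection)

private variable
  n m k a d c : ℕ
  x y : Fin n
  X : Set

-- Finite subsets

x∈p─q⇒x∉q : ∀ (p q : Subset n) → x ∈ₛ p ─ q → x ∉ₛ q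
x∈p─q⇒x∉q (_ ∷ p) (_ ∷ q) (there x∈) (there x∈q) = x∈p─q⇒x∉q p q x∈ x∈q

x∈p-y⇒x≢y : ∀ (p : Subset n) → x ∈ₛ p - y → x ≢ y
x∈p-y⇒x≢y {y = y} p x∈ refl = x∈p─q⇒x∉q p ⁅ y ⁆ x∈ (x∈⁅x⁆ y)

p∩[q─r]≡p∩q─r : ∀ (p q r : Subset n) → p ∩ (q ─ r) ≡ p ∩ q ─ r
p∩[q─r]≡p∩q─r [] [] [] = refl
p∩[q─r]≡p∩q─r (inside  ∷ p) (_ ∷ q) (inside  ∷ r) = cong (_ ∷_) (p∩[q─r]≡p∩q─r p q r)
p∩[q─r]≡p∩q─r (outside ∷ p) (_ ∷ q) (inside  ∷ r) = cong (_ ∷_) (p∩[q─r]≡p∩q─r p q r)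
p∩[q─r]≡p∩q─r (_       ∷ p) (_ ∷ q) (outside ∷ r) = cong (_ ∷_) (p∩[q─r]≡p∩q─r p q r)

x∉p⇒p-x≡p : ∀ (p : Subset n) → x ∉ₛ p → p - x ≡ p
x∉p⇒p-x≡p {x = x} p x∉p = ⊆-antisym (p─q⊆p p ⁅ x ⁆)
  (λ y∈p → x∈p∧x≢y⇒x∈p-y y∈p λ { refl → x∉p y∈p })

∣p∩q∣+∣p─q∣≡∣p∣ : ∀ (p q : Subset n) → ∣ p ∩ q ∣ + ∣ p ─ q ∣ ≡ ∣ p ∣
∣p∩q∣+∣p─q∣≡∣p∣ [] [] = refl
∣p∩q∣+∣p─q∣≡∣p∣ (outside ∷ p) (outside ∷ q) = ∣p∩q∣+∣p─q∣≡∣p∣ p q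
∣p∩q∣+∣p─q∣≡∣p∣ (outside ∷ p) (inside  ∷ q) = ∣p∩q∣+∣p─q∣≡∣p∣ p q
∣p∩q∣+∣p─q∣≡∣p∣ (inside  ∷ p) (outside ∷ q) =
  trans (+-suc ∣ p ∩ q ∣ ∣ p ─ q ∣) (cong suc (∣p∩q∣+∣p─q∣≡∣p∣ p q))
∣p∩q∣+∣p─q∣≡∣p∣ (inside  ∷ p) (inside  ∷ q) = cong suc (∣p∩q∣+∣p─q∣≡∣p∣ p q)

∣p∪q∣≡∣p∣+∣q─p∣ : ∀ (p q : Subset n) → ∣ p ∪ q ∣ ≡ ∣ p ∣ + ∣ q ─ p ∣
∣p∪q∣≡∣p∣+∣q─p∣ [] [] = refl
∣p∪q∣≡∣p∣+∣q─p∣ (outside ∷ p) (outside ∷ q) = ∣p∪q∣≡∣p∣+∣q─p∣ p q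
∣p∪q∣≡∣p∣+∣q─p∣ (outside ∷ p) (inside  ∷ q) =
  trans (cong suc (∣p∪q∣≡∣p∣+∣q─p∣ p q)) (sym (+-suc ∣ p ∣ ∣ q ─ p ∣))
∣p∪q∣≡∣p∣+∣q─p∣ (inside  ∷ p) (outside ∷ q) = cong suc (∣p∪q∣≡∣p∣+∣q─p∣ p q)
∣p∪q∣≡∣p∣+∣q─p∣ (inside  ∷ p) (inside  ∷ q) = cong suc (∣p∪q∣≡∣p∣+∣q─p∣ p q)

∣p∪q∣≤∣p∣+∣q∣ : ∀ (p q : Subset n) → ∣ p ∪ q ∣ ≤ ∣ p ∣ + ∣ q ∣
∣p∪q∣≤∣p∣+∣q∣ p q = ≤-trans (≤-reflexive (∣p∪q∣≡∣p∣+∣q─p∣ p q))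
  (+-monoʳ-≤ ∣ p ∣ (∣p─q∣≤∣p∣ q p))

∣p∣≤1+∣p-x∣ : ∀ (p : Subset n) x → ∣ p ∣ ≤ suc ∣ p - x ∣
∣p∣≤1+∣p-x∣ p x = begin
  ∣ p ∣                       ≡⟨ ∣p∩q∣+∣p─q∣≡∣p∣ p ⁅ x ⁆ ⟨
  ∣ p ∩ ⁅ x ⁆ ∣ + ∣ p - x ∣   ≤⟨ +-monoˡ-≤ ∣ p - x ∣ (∣p∩q∣≤∣q∣ p ⁅ x ⁆) ⟩
  ∣ ⁅ x ⁆ ∣ + ∣ p - x ∣       ≡⟨ cong (_+ ∣ p - x ∣) (∣⁅x⁆∣≡1 x) ⟩
  suc ∣ p - x ∣               ∎
  where open ≤-Reasoning

x∈p⇒1+∣p-x∣≡∣p∣ : ∀ (p : Subset n) → x ∈ₛ p → suc ∣ p - x ∣ ≡ ∣ p ∣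
x∈p⇒1+∣p-x∣≡∣p∣ {x = x} p x∈p = ≤-antisym (x∈p⇒∣p-x∣<∣p∣ x∈p) (∣p∣≤1+∣p-x∣ p x)

0<∣p∣⇒Nonempty : ∀ (p : Subset n) → 0 < ∣ p ∣ → Nonempty p
0<∣p∣⇒Nonempty (inside  ∷ p) _ = zero , here
0<∣p∣⇒Nonempty (outside ∷ p) 0<∣p∣ with 0<∣p∣⇒Nonempty p 0<∣p∣
... | x , x∈p = suc x , there x∈p

2≤∣p∣⇒∃≢ : ∀ (p : Subset n) → 2 ≤ ∣ p ∣ → ∀ x → ∃[ y ] y ∈ₛ p × y ≢ x
2≤∣p∣⇒∃≢ p 2≤∣p∣ x with 0<∣p∣⇒Nonempty (p - x) (s≤s⁻¹ (≤-trans 2≤∣p∣ (∣p∣≤1+∣p-x∣ p x)))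
... | y , y∈p-x = y , p─q⊆p p ⁅ x ⁆ y∈p-x , x∈p-y⇒x≢y p y∈p-x

∣p∣≡∣q∣∧q≢p⇒Nonempty[p─q] : ∀ (p q : Subset n) → ∣ p ∣ ≡ ∣ q ∣ → q ≢ p → Nonempty (p ─ q)
∣p∣≡∣q∣∧q≢p⇒Nonempty[p─q] [] [] _ q≢p = contradiction refl q≢p
∣p∣≡∣q∣∧q≢p⇒Nonempty[p─q] (inside ∷ p) (outside ∷ q) _ _ = zero , here
∣p∣≡∣q∣∧q≢p⇒Nonempty[p─q] (outside ∷ p) (outside ∷ q) eq q≢p
  with ∣p∣≡∣q∣∧q≢p⇒Nonempty[p─q] p q eq (q≢p ∘ cong (outside ∷_))
... | x , x∈ = suc x , there x∈
∣p∣≡∣q∣∧q≢p⇒Nonempty[p─q] (inside ∷ p) (inside ∷ q) eq q≢p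
  with ∣p∣≡∣q∣∧q≢p⇒Nonempty[p─q] p q (suc-injective eq) (q≢p ∘ cong (inside ∷_))
... | x , x∈ = suc x , there x∈
-- For the tails, `∣ p ∣` is `1 + ∣ q ∣`, so `p` cannot lie inside `q`.
∣p∣≡∣q∣∧q≢p⇒Nonempty[p─q] (outside ∷ p) (inside ∷ q) eq _ =
  let x , x∈ = 0<∣p∣⇒Nonempty (p ─ q) (+-cancelˡ-< (∣ p ∩ q ∣) 0 (∣ p ─ q ∣) (begin-strict
        ∣ p ∩ q ∣ + 0           ≡⟨ +-identityʳ _ ⟩
        ∣ p ∩ q ∣               ≤⟨ ∣p∩q∣≤∣q∣ p q ⟩
        ∣ q ∣                   <⟨ ≤-reflexive (sym eq) ⟩
        ∣ p ∣                   ≡⟨ ∣p∩q∣+∣p─q∣≡∣p∣ p q ⟨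
        ∣ p ∩ q ∣ + ∣ p ─ q ∣   ∎))
  in suc x , there x∈
  where open ≤-Reasoning

interpolate : ∀ (p q : Subset n) → p ⊆ q → ∣ p ∣ ≤ m → m ≤ ∣ q ∣ →
  ∃[ r ] p ⊆ r × r ⊆ q × ∣ r ∣ ≡ m
interpolate [] [] _ _ z≤n = [] , (λ x∈ → x∈) , (λ x∈ → x∈) , refl
interpolate (inside ∷ p) (outside ∷ q) p⊆q _ _ with () ← p⊆q here
interpolate (outside ∷ p) (outside ∷ q) p⊆q p≤m m≤q
  with interpolate p q (drop-∷-⊆ p⊆q) p≤m m≤q
... | r , p⊆r , r⊆q , eq = outside ∷ r , s⊆s p⊆r , s⊆s r⊆q , eq
interpolate (inside ∷ p) (inside ∷ q) p⊆q (s≤s p≤m) (s≤s m≤q)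
  with interpolate p q (drop-∷-⊆ p⊆q) p≤m m≤q
... | r , p⊆r , r⊆q , eq = inside ∷ r , s⊆s p⊆r , s⊆s r⊆q , cong suc eq
interpolate {m = m} (outside ∷ p) (inside ∷ q) p⊆q p≤m m≤1+q with m ≤? ∣ q ∣
-- A head outside `p` is taken only when the tail `q` is too small; then `m` is `1 + ∣ q ∣` and all
-- of `inside ∷ q` is the answer.
... | no m≰q =
  inside ∷ q , out⊆ (drop-∷-⊆ p⊆q) , ⊆-refl , ≤-antisym (≰⇒> m≰q) m≤1+q
... | yes m≤q with interpolate p q (drop-∷-⊆ p⊆q) p≤m m≤q
...   | r , p⊆r , r⊆q , eq = outside ∷ r , s⊆s p⊆r , out⊆ r⊆q , eq

choose : ∀ (p : Subset n) → m ≤ ∣ p ∣ → ∃[ r ] r ⊆ p × ∣ r ∣ ≡ m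
choose {n = n} p m≤p
  with interpolate Subset.⊥ p ⊥⊆ (≤-trans (≤-reflexive (∣⊥∣≡0 n)) z≤n) m≤p
... | r , _ , r⊆p , eq = r , r⊆p , eq

-- Each element carries its membership proof because `delete` below needs one to know the size of
-- the set it returns.
elements : (p : Subset n) → List (∃[ x ] x ∈ₛ p)
elements [] = []
elements (inside  ∷ p) = (zero , here) ∷ map (λ (x , x∈p) → suc x , there x∈p) (elements p)
elements (outside ∷ p) = map (λ (x , x∈p) → suc x , there x∈p) (elements p)

length-elements : ∀ (p : Subset n) → length (elements p) ≡ ∣ p ∣
length-elements [] = refl
length-elements (inside  ∷ p) = cong suc (trans (length-map _ (elements p)) (length-elements p))
length-elements (outside ∷ p) = trans (length-map _ (elements p)) (length-elements p)

∈-elements : ∀ (p : Subset n) (x∈p : x ∈ₛ p) → (x , x∈p) ∈ₗ elements p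
∈-elements (inside  ∷ p) here = here refl
∈-elements (inside  ∷ p) (there x∈p) = there (∈-map⁺ _ (∈-elements p x∈p))
∈-elements (outside ∷ p) (there x∈p) = ∈-map⁺ _ (∈-elements p x∈p)

-- Dropping the head of the list takes at most one element out of `p`, and the tail covers what
-- remains. Repeated entries only make the list longer.
covered⇒∣p∣≤length : ∀ (p : Subset n) xs → (∀ {x} → x ∈ₛ p → x ∈ₗ xs) → ∣ p ∣ ≤ length xs
covered⇒∣p∣≤length {n} p [] cover =
  ≤-reflexive (trans (cong ∣_∣ (Empty-unique λ (_ , x∈p) → contradiction (cover x∈p) λ ())) (∣⊥∣≡0 n))
covered⇒∣p∣≤length p (x ∷ xs) cover = ≤-trans (∣p∣≤1+∣p-x∣ p x)
  (s≤s (covered⇒∣p∣≤length (p - x) xs λ y∈ →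
    drop-head (x∈p-y⇒x≢y p y∈) (cover (p─q⊆p p ⁅ x ⁆ y∈))))
  where
  drop-head : ∀ {y} → y ≢ x → y ∈ₗ x ∷ xs → y ∈ₗ xs
  drop-head y≢x (here y≡x) = contradiction y≡x y≢x
  drop-head _ (there y∈xs) = y∈xs

-- A requirement that survives enlarging the set is met for all entries at once by the union of the
-- individual witnesses. This serves twice: for `Hits` with `c = 1` and for `Curbs` with
-- `c = d + 1`.
common-superset : (P : X → Subset n → Set) → (∀ {x q r} → q ⊆ r → P x q → P x r) →
  (∀ x → ∃[ q ] P x q × ∣ q ∣ ≤ c) →
  ∀ xs → ∃[ q ] (∀ {x} → x ∈ₗ xs → P x q) × ∣ q ∣ ≤ length xs * c
common-superset {n = n} P mono small [] = Subset.⊥ , (λ ()) , ≤-reflexive (∣⊥∣≡0 n)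
common-superset P mono small (x ∷ xs) with small x | common-superset P mono small xs
... | q , Pxq , q≤c | r , Pr , r≤ = q ∪ r
  , (λ { (here refl) → mono (p⊆p∪q r) Pxq ; (there y∈xs) → mono (q⊆p∪q q r) (Pr y∈xs) })
  , ≤-trans (∣p∪q∣≤∣p∣+∣q∣ q r) (+-mono-≤ q≤c r≤)

-- Zero forcing

module _ (G : Graph) where
  open Graph G
  open ZeroForcing G renaming (_∈_ to _∈ᵥ_; _∉_ to _∉ᵥ_)
  open Inverse index using (to; from; strictlyInverseʳ; strictlyInverseˡ)

  _≟ᵥ_ : DecidableEquality Vertex
  _≟ᵥ_ = via-injection (Inverse⇒Injection index) Fin._≟_

  open DecMembership _≟ᵥ_ using () renaming (_∈?_ to _∈ₗ?_)

  -- Whiteness of all of `F` is invariant: a vertex forcing a member of `F` would have a second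
  -- neighbour in `F`, also white, against the uniqueness of its white neighbour.
  fort-blocks : ∀ F {v} → v ∈ᵥ F →
    (∀ {u v} → v ∈ᵥ F → u ~ v → ∃[ w ] w ∈ᵥ F × u ~ w × w ≢ v) → ZeroBlockingSet F
  fort-blocks F {v} v∈F fort (T , steps , all-black) =
    contradiction (trans (sym (all-black v)) (stays-white steps (λ w w∈F → cong not w∈F) v v∈F)) λ ()
    where
    White : VertexSet → Set
    White S = ∀ w → w ∈ᵥ F → w ∉ᵥ S

    step-white : ∀ {S T} → S ⟶ T → White S → White T
    step-white s white w w∈F = trans (unchanged w w≢v) (white w w∈F)
      where
      open _⟶_ s renaming (v to v′)
      w≢v : w ≢ v′
      w≢v refl with fort w∈F u~v
      ... | w′ , w′∈F , u~w′ , w′≢v = w′≢v (only w′ u~w′ (white w′ w′∈F))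

    stays-white : ∀ {S T} → Star _⟶_ S T → White S → White T
    stays-white ε white = white
    stays-white (s ◅ ss) white = stays-white ss (step-white s white)

  -- Think of `v ∷ vs` as a list containing every white vertex. Then `v` is the only possible white
  -- neighbour of `u`, and `u ≢ w`, with irreflexivity at `v`, makes `u` black. The guard `w ≢ v`
  -- lets `v` recur in `vs`.
  Isolable : ℕ → Set
  Isolable b = ∀ v vs → length (v ∷ vs) < b →
    ∃[ u ] u ~ v × (∀ w → w ∈ₗ vs → w ≢ v → ¬ (u ~ w) × u ≢ w)

  -- The list contains the white vertices and perhaps others, so it can lose its head at every turn:
  -- either the head is black already, or its isolating neighbour forces it. The shorter list still
  -- meets the bound `b`.
  few-white⇒forcing : ∀ {b} → Isolable b → ∀ vs → length vs < b →
    ∀ S → (∀ w → w ∉ᵥ S → w ∈ₗ vs) → ZeroForcingSet S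
  few-white⇒forcing iso [] _ S whites = S , ε , all-black
    where
    all-black : ∀ v → v ∈ᵥ S
    all-black v with S v in eq
    ... | true = refl
    ... | false = contradiction (whites v eq) λ ()
  few-white⇒forcing iso (v ∷ vs) vs<b S whites with S v in Sv
  ... | true = few-white⇒forcing iso vs (<⇒≤ vs<b) S whites′
    where
    whites′ : ∀ w → w ∉ᵥ S → w ∈ₗ vs
    whites′ w w∉S with whites w w∉S
    ... | here refl = contradiction (trans (sym Sv) w∉S) λ ()
    ... | there w∈vs = w∈vs
  ... | false with iso v vs vs<b
  ...   | u , u~v , iso-u = let T′ , steps , black = few-white⇒forcing iso vs (<⇒≤ vs<b) T T-whites
                            in T′ , step ◅ steps , black
    where
    T : VertexSet
    T w = S w ∨ does (w ≟ᵥ v)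

    white-≢ : ∀ w → w ∉ᵥ S → w ≢ v → w ∈ₗ vs
    white-≢ w w∉S w≢v with whites w w∉S
    ... | here w≡v = contradiction w≡v w≢v
    ... | there w∈vs = w∈vs

    u-black : u ∈ᵥ S
    u-black with S u in Su
    ... | true = refl
    ... | false = contradiction refl (proj₂ (iso-u u (white-≢ u Su u≢v) u≢v))
      where
      u≢v : u ≢ v
      u≢v u≡v = ~-irrefl u≡v u~v

    only : ∀ w → u ~ w → w ∉ᵥ S → w ≡ v
    only w u~w w∉S with w ≟ᵥ v
    ... | yes w≡v = w≡v
    ... | no w≢v = contradiction u~w (proj₁ (iso-u w (white-≢ w w∉S w≢v) w≢v))

    v-forced : v ∈ᵥ T
    v-forced rewrite dec-true (v ≟ᵥ v) refl = ∨-zeroʳ (S v)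

    unchanged : ∀ w → w ≢ v → T w ≡ S w
    unchanged w w≢v rewrite dec-false (w ≟ᵥ v) w≢v = ∨-identityʳ (S w)

    step : S ⟶ T
    step = record
      { u = u ; v = v ; u-black = u-black ; u~v = u~v ; v-white = Sv
      ; only = only ; v-forced = v-forced ; unchanged = unchanged }

    T-whites : ∀ w → w ∉ᵥ T → w ∈ₗ vs
    T-whites w w∉T with w ≟ᵥ v
    ... | yes refl = contradiction (trans (sym v-forced) w∉T) λ ()
    ... | no w≢v = white-≢ w (trans (sym (unchanged w w≢v)) w∉T) w≢v

  -- Sizes of vertex sets and the zero blocking number

  toSubset : VertexSet → Subset order
  toSubset S = tabulate (S ∘ from)

  ∈-toSubset⁺ : ∀ S v → v ∈ᵥ S → to v ∈ₛ toSubset S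
  ∈-toSubset⁺ S v v∈S = lookup⇒[]= (to v) _ (trans (lookup∘tabulate _ (to v))
    (trans (cong S (strictlyInverseʳ v)) v∈S))

  ∈-toSubset⁻ : ∀ S {i} → i ∈ₛ toSubset S → from i ∈ᵥ S
  ∈-toSubset⁻ S {i} i∈ = trans (sym (lookup∘tabulate _ i)) ([]=⇒lookup i∈)

  members : ∀ S → ∃[ vs ] length vs ≡ size S × (∀ v → v ∈ᵥ S → v ∈ₗ vs)
  members S = map (from ∘ proj₁) (elements (toSubset S))
    , trans (length-map _ (elements (toSubset S))) (length-elements (toSubset S))
    , λ v v∈S → subst (_∈ₗ _) (strictlyInverseʳ v)
        (∈-map⁺ (from ∘ proj₁) (∈-elements (toSubset S) (∈-toSubset⁺ S v v∈S)))

  covered⇒size≤length : ∀ S vs → (∀ v → v ∈ᵥ S → v ∈ₗ vs) → size S ≤ length vs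
  covered⇒size≤length S vs cover = ≤-trans
    (covered⇒∣p∣≤length (toSubset S) (map to vs) λ {i} i∈ →
      subst (_∈ₗ _) (strictlyInverseˡ i) (∈-map⁺ to (cover (from i) (∈-toSubset⁻ S i∈))))
    (≤-reflexive (length-map to vs))

  isolable⇒bound : ∀ {b} → Isolable b → ∀ W → ZeroBlockingSet W → b ≤ size W
  isolable⇒bound iso W blocking = ≮⇒≥ λ size<b →
    let vs , eq , cover = members W
    in blocking (few-white⇒forcing iso vs (≤-trans (s≤s (≤-reflexive eq)) size<b) (complement W)
         λ w w∉ → cover w (not-false (W w) w∉))
    where
    not-false : ∀ x → not x ≡ false → x ≡ true
    not-false true _ = refl

  -- The fort has at most `length vs`, that is `b`, vertices. Being blocking, it has at least `b` by
  -- isolability, so equality follows without comparing the listed vertices with one another.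
  isolable∧fort⇒B : ∀ {b} → Isolable b → ∀ {v} vs → v ∈ₗ vs → length vs ≡ b →
    (∀ {u w} → w ∈ₗ vs → u ~ w → ∃[ w′ ] w′ ∈ₗ vs × u ~ w′ × w′ ≢ w) →
    B[ G ]≡ b
  isolable∧fort⇒B {b} iso vs v∈vs len fort =
    (F , blocking , ≤-antisym (≤-trans (covered⇒size≤length F vs (λ _ → ∈F⁻)) (≤-reflexive len))
                              (isolable⇒bound iso F blocking))
    , isolable⇒bound iso
    where
    F : VertexSet
    F w = does (w ∈ₗ? vs)

    ∈F⁺ : ∀ {w} → w ∈ₗ vs → w ∈ᵥ F
    ∈F⁺ = dec-true (_ ∈ₗ? _)

    ∈F⁻ : ∀ {w} → w ∈ᵥ F → w ∈ₗ vs
    ∈F⁻ {w} w∈F with w ∈ₗ? vs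
    ... | yes w∈ = w∈

    blocking : ZeroBlockingSet F
    blocking = fort-blocks F (∈F⁺ v∈vs) λ w∈F u~w →
      let w′ , w′∈ , u~w′ , w′≢w = fort (∈F⁻ w∈F) u~w in w′ , ∈F⁺ w′∈ , u~w′ , w′≢w

-- Generalized Johnson graphs

module _ (A : KSubset n k) (d : ℕ) where
  private A′ = proj₁ A

  -- The case `X ≡ A` makes the requirement satisfiable for every `X`, as `common-superset` asks,
  -- even if `A` occurs in the list.
  Hits : KSubset n k → Subset n → Set
  Hits X q = X ≡ A ⊎ (∃[ x ] x ∈ₛ q × x ∈ₛ A′ ─ proj₁ X)

  hitting-set : ∀ Xs → ∃[ H ] (∀ {X} → X ∈ₗ Xs → Hits X H) × ∣ H ∣ ≤ length Xs * 1
  hitting-set = common-superset Hits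
    (λ { _ (inj₁ eq) → inj₁ eq ; q⊆r (inj₂ (x , x∈q , x∈)) → inj₂ (x , q⊆r x∈q , x∈) })
    small
    where
    small : ∀ X → ∃[ q ] Hits X q × ∣ q ∣ ≤ 1
    small X with ≡-dec Bool._≟_ (proj₁ X) A′
    ... | yes eq = Subset.⊥ , inj₁ (KSubset-≡ eq) , ≤-trans (≤-reflexive (∣⊥∣≡0 n)) z≤n
    ... | no X≢A with ∣p∣≡∣q∣∧q≢p⇒Nonempty[p─q] A′ (proj₁ X) (trans (proj₂ A) (sym (proj₂ X))) X≢A
    ...   | x , x∈ = ⁅ x ⁆ , inj₂ (x , x∈⁅x⁆ x , x∈) , ≤-reflexive (∣⁅x⁆∣≡1 x)

  -- Let `T` lie in `A` and let `R` avoid both `A` and `q`. The first alternative leaves `R` no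
  -- point of `X`; the second keeps more than `d` points of `X` out of `T ∪ R`. Stopping at `d + 1`
  -- bounds the cost of each `X`.
  Curbs : KSubset n k → Subset n → Set
  Curbs X q = proj₁ X ─ A′ ⊆ q ⊎ suc d ≤ ∣ (proj₁ X ─ A′) ∩ q ∣

  forbidden-set : ∀ Xs → ∃[ F ] (∀ {X} → X ∈ₗ Xs → Curbs X F) × ∣ F ∣ ≤ length Xs * suc d
  forbidden-set = common-superset Curbs (λ {X} → mono {X}) small
    where
    mono : ∀ {X q r} → q ⊆ r → Curbs X q → Curbs X r
    mono q⊆r (inj₁ X─A⊆q) = inj₁ λ x∈ → q⊆r (X─A⊆q x∈)
    mono {X} {q} q⊆r (inj₂ d<) = inj₂ (≤-trans d< (p⊆q⇒∣p∣≤∣q∣ λ x∈ →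
      let x∈X─A , x∈q = x∈p∩q⁻ (proj₁ X ─ A′) q x∈ in x∈p∩q⁺ (x∈X─A , q⊆r x∈q)))

    small : ∀ X → ∃[ q ] Curbs X q × ∣ q ∣ ≤ suc d
    small X with ≤-total ∣ proj₁ X ─ A′ ∣ (suc d)
    ... | inj₁ ≤1+d = proj₁ X ─ A′ , inj₁ ⊆-refl , ≤1+d
    ... | inj₂ 1+d≤ with choose (proj₁ X ─ A′) 1+d≤
    ...   | q , q⊆ , eq = q
      , inj₂ (≤-trans (≤-reflexive (sym eq)) (p⊆q⇒∣p∣≤∣q∣ λ x∈q → x∈p∩q⁺ (q⊆ x∈q , x∈q)))
      , ≤-reflexive eq

  isolating-set : a + d ≡ k → k + a * suc d + d ≤ n → ∀ Xs → length Xs ≤ a →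
    Σ (KSubset n k) λ B → ∣ proj₁ B ∩ A′ ∣ ≡ a ×
      (∀ X → X ∈ₗ Xs → X ≢ A → ∣ proj₁ B ∩ proj₁ X ∣ < a)
  isolating-set {a = a} a+d≡k room Xs len
    with hitting-set Xs | forbidden-set Xs
  ... | H , hits , ∣H∣≤ | F , curbs , ∣F∣≤
    -- `T` is the part of the new set inside `A`, and `R` the part outside. The hitting points are
    -- elements of `A`, so `T` catches them by containing `H ∩ A′`.
    with interpolate {m = a} (H ∩ A′) A′ (p∩q⊆q H A′) ∣H∩A∣≤a a≤∣A∣ | choose {m = d} (∁ (A′ ∪ F)) d≤
    where
    open ≤-Reasoning
    ∣H∩A∣≤a : ∣ H ∩ A′ ∣ ≤ a
    ∣H∩A∣≤a = begin
      ∣ H ∩ A′ ∣     ≤⟨ ∣p∩q∣≤∣p∣ H A′ ⟩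
      ∣ H ∣          ≤⟨ ∣H∣≤ ⟩
      length Xs * 1  ≡⟨ *-identityʳ _ ⟩
      length Xs      ≤⟨ len ⟩
      a              ∎
    a≤∣A∣ : a ≤ ∣ A′ ∣
    a≤∣A∣ = begin
      a       ≤⟨ m≤m+n a d ⟩
      a + d   ≡⟨ a+d≡k ⟩
      k       ≡⟨ proj₂ A ⟨
      ∣ A′ ∣  ∎
    d≤ : d ≤ ∣ ∁ (A′ ∪ F) ∣
    d≤ = subst (d ≤_) (sym (∣∁p∣≡n∸∣p∣ (A′ ∪ F))) (m+n≤o⇒m≤o∸n d (begin
      d + ∣ A′ ∪ F ∣                  ≤⟨ +-monoʳ-≤ d (∣p∪q∣≤∣p∣+∣q∣ A′ F) ⟩
      d + (∣ A′ ∣ + ∣ F ∣)            ≤⟨ +-monoʳ-≤ d (+-mono-≤ (≤-reflexive (proj₂ A)) ∣F∣≤) ⟩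
      d + (k + length Xs * suc d)     ≤⟨ +-monoʳ-≤ d (+-monoʳ-≤ k (*-monoˡ-≤ (suc d) len)) ⟩
      d + (k + a * suc d)             ≡⟨ +-comm d _ ⟩
      k + a * suc d + d               ≤⟨ room ⟩
      n                               ∎))
  ... | T , H∩A⊆T , T⊆A , ∣T∣≡a | R , R⊆ , ∣R∣≡d = (T ∪ R , ∣B∣≡k) , ∣B∩A∣≡a , few
    where
    open ≤-Reasoning
    R∌A : ∀ {x} → x ∈ₛ R → x ∉ₛ A′
    R∌A x∈R x∈A = x∈∁p⇒x∉p (R⊆ x∈R) (x∈p∪q⁺ (inj₁ x∈A))

    R∌F : ∀ {x} → x ∈ₛ R → x ∉ₛ F
    R∌F x∈R x∈F = x∈∁p⇒x∉p (R⊆ x∈R) (x∈p∪q⁺ (inj₂ x∈F))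

    ∣B∣≡k : ∣ T ∪ R ∣ ≡ k
    ∣B∣≡k = begin-equality
      ∣ T ∪ R ∣            ≡⟨ ∣p∪q∣≡∣p∣+∣q─p∣ T R ⟩
      ∣ T ∣ + ∣ R ─ T ∣    ≡⟨ cong₂ _+_ ∣T∣≡a (cong ∣_∣ (⊆-antisym (p─q⊆p R T)
                               λ x∈R → x∈p∧x∉q⇒x∈p─q x∈R (R∌A x∈R ∘ T⊆A))) ⟩
      a + ∣ R ∣            ≡⟨ cong (a +_) ∣R∣≡d ⟩
      a + d                ≡⟨ a+d≡k ⟩
      k                    ∎

    B∩A⊆T : (T ∪ R) ∩ A′ ⊆ T
    B∩A⊆T x∈ with x∈p∩q⁻ (T ∪ R) A′ x∈
    ... | x∈B , x∈A with x∈p∪q⁻ T R x∈B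
    ...   | inj₁ x∈T = x∈T
    ...   | inj₂ x∈R = contradiction x∈A (R∌A x∈R)

    ∣B∩A∣≡a : ∣ (T ∪ R) ∩ A′ ∣ ≡ a
    ∣B∩A∣≡a = trans (cong ∣_∣ (⊆-antisym B∩A⊆T
      λ x∈T → x∈p∩q⁺ (x∈p∪q⁺ (inj₁ x∈T) , T⊆A x∈T))) ∣T∣≡a

    few : ∀ X → X ∈ₗ Xs → X ≢ A → ∣ (T ∪ R) ∩ proj₁ X ∣ < a
    few X X∈ X≢A with hits X∈ | curbs X∈
    ... | inj₁ X≡A | _ = contradiction X≡A X≢A
    -- `R` misses `X` altogether, and `T` contains `y`, which is not in `X`.
    ... | inj₂ (y , y∈H , y∈A─X) | inj₁ X─A⊆F = begin-strict
      ∣ (T ∪ R) ∩ proj₁ X ∣  ≤⟨ p⊆q⇒∣p∣≤∣q∣ B∩X⊆T-y ⟩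
      ∣ T - y ∣              <⟨ x∈p⇒∣p-x∣<∣p∣ (H∩A⊆T (x∈p∩q⁺ (y∈H , p─q⊆p A′ (proj₁ X) y∈A─X))) ⟩
      ∣ T ∣                  ≡⟨ ∣T∣≡a ⟩
      a                      ∎
      where
      B∩X⊆T-y : (T ∪ R) ∩ proj₁ X ⊆ T - y
      B∩X⊆T-y x∈ with x∈p∩q⁻ (T ∪ R) (proj₁ X) x∈
      ... | x∈B , x∈X with x∈p∪q⁻ T R x∈B
      ...   | inj₁ x∈T = x∈p∧x≢y⇒x∈p-y x∈T λ { refl → x∈p─q⇒x∉q A′ (proj₁ X) y∈A─X x∈X }
      ...   | inj₂ x∈R = contradiction (X─A⊆F (x∈p∧x∉q⇒x∈p─q x∈X (R∌A x∈R))) (R∌F x∈R)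
    -- At least `d + 1` of the `a + d` elements of `X` lie in `E` and escape `T ∪ R`, leaving fewer
    -- than `a`.
    ... | inj₂ _ | inj₂ 1+d≤ = +-cancelʳ-< d _ a (begin-strict
      ∣ (T ∪ R) ∩ proj₁ X ∣ + d               ≤⟨ +-monoˡ-≤ d (p⊆q⇒∣p∣≤∣q∣ B∩X⊆X─E) ⟩
      ∣ proj₁ X ─ E ∣ + d                     <⟨ +-monoʳ-< ∣ proj₁ X ─ E ∣ 1+d≤ ⟩
      ∣ proj₁ X ─ E ∣ + ∣ E ∣                 ≤⟨ +-monoʳ-≤ ∣ proj₁ X ─ E ∣ (p⊆q⇒∣p∣≤∣q∣ λ x∈E →
                                                   x∈p∩q⁺ (E⊆X x∈E , x∈E)) ⟩
      ∣ proj₁ X ─ E ∣ + ∣ proj₁ X ∩ E ∣       ≡⟨ +-comm ∣ proj₁ X ─ E ∣ _ ⟩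
      ∣ proj₁ X ∩ E ∣ + ∣ proj₁ X ─ E ∣       ≡⟨ ∣p∩q∣+∣p─q∣≡∣p∣ (proj₁ X) E ⟩
      ∣ proj₁ X ∣                             ≡⟨ proj₂ X ⟩
      k                                       ≡⟨ a+d≡k ⟨
      a + d                                   ∎)
      where
      E : Subset n
      E = (proj₁ X ─ A′) ∩ F

      E⊆X : E ⊆ proj₁ X
      E⊆X x∈E = p─q⊆p (proj₁ X) A′ (p∩q⊆p (proj₁ X ─ A′) F x∈E)

      B∩X⊆X─E : (T ∪ R) ∩ proj₁ X ⊆ proj₁ X ─ E
      B∩X⊆X─E {x} x∈ with x∈p∩q⁻ (T ∪ R) (proj₁ X) x∈
      ... | x∈B , x∈X = x∈p∧x∉q⇒x∈p─q x∈X x∉E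
        where
        -- `E` lies outside `A`, hence misses `T`, and inside `F`, hence misses `R`.
        x∉E : x ∉ₛ E
        x∉E x∈E with x∈p∩q⁻ (proj₁ X ─ A′) F x∈E | x∈p∪q⁻ T R x∈B
        ... | x∈X─A , _ | inj₁ x∈T = x∈p─q⇒x∉q (proj₁ X) A′ x∈X─A (T⊆A x∈T)
        ... | _ , x∈F   | inj₂ x∈R = R∌F x∈R x∈F

J-isolable : (a<k : a < k) → a + d ≡ k → k + a * suc d + d ≤ n → Isolable (J n k a a<k) (a + 2)
J-isolable {a = a} {d = d} a<k a+d≡k room A Xs len
  -- `A ∷ Xs` has fewer than `a + 2` entries, so `Xs` has at most `a`.
  with isolating-set A d a+d≡k room Xs (s≤s⁻¹ (s≤s⁻¹ (≤-trans len (≤-reflexive (+-comm a 2)))))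
... | B , B~A , few = B , B~A , λ X X∈ X≢A →
  let ∣B∩X∣<a = few X X∈ X≢A in
    (λ B~X → <-irrefl B~X ∣B∩X∣<a)
  -- A set equal to `B` would meet `B` in `k > a` elements.
  , λ { refl → <-asym a<k (subst (_< a) (trans (cong ∣_∣ (∩-idem (proj₁ B))) (proj₂ B)) ∣B∩X∣<a) }

-- The fort of one-point deletions

module _ {M S : Subset n} (S⊆M : S ⊆ M) (∣M∣≡1+k : ∣ M ∣ ≡ suc k) (∣S∣≡a+2 : ∣ S ∣ ≡ a + 2)
         (k≤2a : k ≤ 2 * a) where

  delete : ∃[ s ] s ∈ₛ S → KSubset n k
  delete (s , s∈S) = M - s , suc-injective (trans (x∈p⇒1+∣p-x∣≡∣p∣ M (S⊆M s∈S)) ∣M∣≡1+k)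

  -- `t` survives in `M - s` but not in `M - t`.
  delete-≢ : ∀ {s t} (s∈S : s ∈ₛ S) (t∈S : t ∈ₛ S) → t ≢ s → delete (t , t∈S) ≢ delete (s , s∈S)
  delete-≢ {t = t} _ t∈S t≢s eq =
    x∈p-y⇒x≢y M (subst (t ∈ₛ_) (sym (cong proj₁ eq)) (x∈p∧x≢y⇒x∈p-y (S⊆M t∈S) t≢s)) refl

  -- `u` meets `M - t` in `∣ u ∩ M ∣` elements, less one if `t` is in `u`. So every `t` in `S` on
  -- the same side of `u` as `s` gives the same count, and two elements of `S` on that side suffice.
  delete-fort : ∀ u {s} → s ∈ₛ S → ∣ u ∩ (M - s) ∣ ≡ a →
    ∃[ t ] t ∈ₛ S × ∣ u ∩ (M - t) ∣ ≡ a × t ≢ s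
  delete-fort u {s} s∈S u~s = [ inside-case , outside-case ]′ (toSum (s ∈? u))
    where
    open ≤-Reasoning

    1+∣u∩[M-t]∣≡∣u∩M∣ : ∀ {t} → t ∈ₛ S → t ∈ₛ u → suc ∣ u ∩ (M - t) ∣ ≡ ∣ u ∩ M ∣
    1+∣u∩[M-t]∣≡∣u∩M∣ {t} t∈S t∈u = trans (cong (suc ∘ ∣_∣) (p∩[q─r]≡p∩q─r u M ⁅ t ⁆))
      (x∈p⇒1+∣p-x∣≡∣p∣ (u ∩ M) (x∈p∩q⁺ (t∈u , S⊆M t∈S)))

    ∣u∩[M-t]∣≡∣u∩M∣ : ∀ {t} → t ∉ₛ u → ∣ u ∩ (M - t) ∣ ≡ ∣ u ∩ M ∣
    ∣u∩[M-t]∣≡∣u∩M∣ {t} t∉u = cong ∣_∣ (trans (p∩[q─r]≡p∩q─r u M ⁅ t ⁆)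
      (x∉p⇒p-x≡p (u ∩ M) (t∉u ∘ p∩q⊆p u M)))

    inside-case : s ∈ₛ u → ∃[ t ] t ∈ₛ S × ∣ u ∩ (M - t) ∣ ≡ a × t ≢ s
    inside-case s∈u =
      -- Here `u` has `a + 1` elements in `M`. Since `M ─ S` has `k - a - 1` elements and `k ≤ 2a`,
      -- it holds at most `a - 1` of them, leaving at least two for `S`.
      let t , t∈ , t≢s = 2≤∣p∣⇒∃≢ (u ∩ S) 2≤∣u∩S∣ s
          t∈u , t∈S = x∈p∩q⁻ u S t∈
      in t , t∈S
       , trans (suc-injective (trans (1+∣u∩[M-t]∣≡∣u∩M∣ t∈S t∈u)
                                     (sym (1+∣u∩[M-t]∣≡∣u∩M∣ s∈S s∈u)))) u~s
       , t≢s
      where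
      split : u ∩ M ⊆ (u ∩ S) ∪ (M ─ S)
      split {x} x∈ with x∈p∩q⁻ u M x∈ | x ∈? S
      ... | x∈u , x∈M | yes x∈S = x∈p∪q⁺ (inj₁ (x∈p∩q⁺ (x∈u , x∈S)))
      ... | x∈u , x∈M | no x∉S  = x∈p∪q⁺ (inj₂ (x∈p∧x∉q⇒x∈p─q x∈M x∉S))

      1+a≤ : suc a ≤ ∣ u ∩ S ∣ + ∣ M ─ S ∣
      1+a≤ = begin
        suc a                     ≡⟨ cong suc u~s ⟨
        suc ∣ u ∩ (M - s) ∣       ≡⟨ 1+∣u∩[M-t]∣≡∣u∩M∣ s∈S s∈u ⟩
        ∣ u ∩ M ∣                 ≤⟨ p⊆q⇒∣p∣≤∣q∣ split ⟩
        ∣ (u ∩ S) ∪ (M ─ S) ∣     ≤⟨ ∣p∪q∣≤∣p∣+∣q∣ (u ∩ S) (M ─ S) ⟩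
        ∣ u ∩ S ∣ + ∣ M ─ S ∣     ∎

      ∣M─S∣+[a+2]≤ : ∣ M ─ S ∣ + (a + 2) ≤ suc (2 * a)
      ∣M─S∣+[a+2]≤ = begin
        ∣ M ─ S ∣ + (a + 2)       ≡⟨ cong (∣ M ─ S ∣ +_) ∣S∣≡a+2 ⟨
        ∣ M ─ S ∣ + ∣ S ∣         ≤⟨ +-monoʳ-≤ (∣ M ─ S ∣) (p⊆q⇒∣p∣≤∣q∣ λ x∈S →
                                       x∈p∩q⁺ (S⊆M x∈S , x∈S)) ⟩
        ∣ M ─ S ∣ + ∣ M ∩ S ∣     ≡⟨ +-comm (∣ M ─ S ∣) _ ⟩
        ∣ M ∩ S ∣ + ∣ M ─ S ∣     ≡⟨ ∣p∩q∣+∣p─q∣≡∣p∣ M S ⟩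
        ∣ M ∣                     ≡⟨ ∣M∣≡1+k ⟩
        suc k                     ≤⟨ s≤s k≤2a ⟩
        suc (2 * a)               ∎

      2≤∣u∩S∣ : 2 ≤ ∣ u ∩ S ∣
      -- The bound on `M ─ S` is available without subtraction, as `∣ M ─ S ∣ + (a + 2) ≤ 2a + 1`;
      -- hence `2a + 1` is added to both sides.
      2≤∣u∩S∣ = +-cancelʳ-≤ (suc (2 * a)) 2 _ (begin
        2 + suc (2 * a)                       ≡⟨ solve 1 (λ a →
                                                   con 3 :+ con 2 :* a := con 1 :+ a :+ (a :+ con 2)) refl a ⟩
        suc a + (a + 2)                       ≤⟨ +-monoˡ-≤ (a + 2) 1+a≤ ⟩
        ∣ u ∩ S ∣ + ∣ M ─ S ∣ + (a + 2)       ≡⟨ +-assoc (∣ u ∩ S ∣) _ _ ⟩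
        ∣ u ∩ S ∣ + (∣ M ─ S ∣ + (a + 2))     ≤⟨ +-monoʳ-≤ (∣ u ∩ S ∣) ∣M─S∣+[a+2]≤ ⟩
        ∣ u ∩ S ∣ + suc (2 * a)               ∎)
        where open +-*-Solver

    outside-case : s ∉ₛ u → ∃[ t ] t ∈ₛ S × ∣ u ∩ (M - t) ∣ ≡ a × t ≢ s
    outside-case s∉u =
      -- Here `u` has just `a` elements in `M`, so it misses at least two of the `a + 2` elements of
      -- `S`.
      let t , t∈ , t≢s = 2≤∣p∣⇒∃≢ (S ─ u) 2≤∣S─u∣ s
      in t , p─q⊆p S u t∈
       , trans (∣u∩[M-t]∣≡∣u∩M∣ (x∈p─q⇒x∉q S u t∈)) (trans (sym (∣u∩[M-t]∣≡∣u∩M∣ s∉u)) u~s)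
       , t≢s
      where
      S∩u⊆u∩M : S ∩ u ⊆ u ∩ M
      S∩u⊆u∩M x∈ = let x∈S , x∈u = x∈p∩q⁻ S u x∈ in x∈p∩q⁺ (x∈u , S⊆M x∈S)

      2≤∣S─u∣ : 2 ≤ ∣ S ─ u ∣
      2≤∣S─u∣ = +-cancelˡ-≤ a 2 _ (begin
        a + 2                              ≡⟨ ∣S∣≡a+2 ⟨
        ∣ S ∣                              ≡⟨ ∣p∩q∣+∣p─q∣≡∣p∣ S u ⟨
        ∣ S ∩ u ∣ + ∣ S ─ u ∣              ≤⟨ +-monoˡ-≤ (∣ S ─ u ∣) (p⊆q⇒∣p∣≤∣q∣ S∩u⊆u∩M) ⟩
        ∣ u ∩ M ∣ + ∣ S ─ u ∣              ≡⟨ cong (_+ ∣ S ─ u ∣) (∣u∩[M-t]∣≡∣u∩M∣ s∉u) ⟨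
        ∣ u ∩ (M - s) ∣ + ∣ S ─ u ∣        ≡⟨ cong (_+ ∣ S ─ u ∣) u~s ⟩
        a + ∣ S ─ u ∣                      ∎)

  deletions : List (KSubset n k)
  deletions = map delete (elements S)

  ∈-deletions : ∀ {s} (s∈S : s ∈ₛ S) → delete (s , s∈S) ∈ₗ deletions
  ∈-deletions s∈S = ∈-map⁺ delete (∈-elements S s∈S)

  length-deletions : length deletions ≡ a + 2
  length-deletions = trans (length-map delete (elements S)) (trans (length-elements S) ∣S∣≡a+2)

  deletions-fort : ∀ (u : KSubset n k) {w} → w ∈ₗ deletions → ∣ proj₁ u ∩ proj₁ w ∣ ≡ a →
    ∃[ w′ ] w′ ∈ₗ deletions × ∣ proj₁ u ∩ proj₁ w′ ∣ ≡ a × w′ ≢ w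
  deletions-fort u w∈ u~w with ∈-map⁻ delete w∈
  ... | (s , s∈S) , _ , refl =
    let t , t∈S , u~t , t≢s = delete-fort (proj₁ u) s∈S u~w
    in delete (t , t∈S) , ∈-deletions t∈S , u~t , delete-≢ s∈S t∈S t≢s

  ∃∈deletions : ∃[ w ] w ∈ₗ deletions
  ∃∈deletions with 0<∣p∣⇒Nonempty S (≤-trans (s≤s z≤n)
                     (≤-reflexive (trans (+-comm 2 a) (sym ∣S∣≡a+2))))
  ... | s , s∈S = delete (s , s∈S) , ∈-deletions s∈S

-- The hypothesis is the bound on `n`, doubled and cleared of subtraction. With `d = 2 + e`, its
-- left side is twice the wanted left side plus `12 + e`; the surplus `e` is discarded. At `d = 1`
-- the surplus would be negative.
room-bound : ∀ n a d → a + d ≡ k → 2 ≤ d →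
  (2 * a + 5) * (d + 2) ≤ 2 * n + 12 → k + a * suc d + d ≤ n
room-bound n a (suc (suc e)) refl _ bound = *-cancelˡ-≤ 2 (+-cancelʳ-≤ 12 _ _ (begin
  2 * (a + (2 + e) + a * (3 + e) + (2 + e)) + 12       ≤⟨ m≤m+n _ e ⟩
  2 * (a + (2 + e) + a * (3 + e) + (2 + e)) + 12 + e   ≡⟨ solve 2 (λ a e →
    con 2 :* (a :+ (con 2 :+ e) :+ a :* (con 3 :+ e) :+ (con 2 :+ e)) :+ con 12 :+ e :=
    (con 2 :* a :+ con 5) :* (con 2 :+ e :+ con 2)) refl a e ⟩
  (2 * a + 5) * (2 + e + 2)                            ≤⟨ bound ⟩
  2 * n + 12                                           ∎))
  where
  open ≤-Reasoning
  open +-*-Solver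
room-bound n a (suc zero) _ (s≤s ()) _

theorem16 : ∀ (n k a : ℕ) → k ≤ n → (a<k : a < k) →
    (2 * a + 5) * ((k ∸ a) + 2) ≤ 2 * n + 12 →
    a + 2 ≤ k → k ≤ 2 * a →
    B[ J n k a a<k ]≡ (a + 2)
theorem16 n k a _ a<k bound a+2≤k k≤2a =
  let M , _ , ∣M∣≡1+k = choose Subset.⊤ (≤-trans k<n (≤-reflexive (sym (∣⊤∣≡n n))))
      S , S⊆M , ∣S∣≡a+2 = choose M (≤-trans (m≤n⇒m≤1+n a+2≤k) (≤-reflexive (sym ∣M∣≡1+k)))
  in isolable∧fort⇒B (J n k a a<k) (J-isolable a<k a+d≡k room)
       (deletions S⊆M ∣M∣≡1+k ∣S∣≡a+2 k≤2a)
       (proj₂ (∃∈deletions S⊆M ∣M∣≡1+k ∣S∣≡a+2 k≤2a))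
       (length-deletions S⊆M ∣M∣≡1+k ∣S∣≡a+2 k≤2a)
       (λ {u} → deletions-fort S⊆M ∣M∣≡1+k ∣S∣≡a+2 k≤2a u)
  where
  open ≤-Reasoning

  a+d≡k : a + (k ∸ a) ≡ k
  a+d≡k = m+[n∸m]≡n (<⇒≤ a<k)

  2≤d : 2 ≤ k ∸ a
  2≤d = m+n≤o⇒m≤o∸n 2 (≤-trans (≤-reflexive (+-comm 2 a)) a+2≤k)

  room : k + a * suc (k ∸ a) + (k ∸ a) ≤ n
  room = room-bound n a (k ∸ a) a+d≡k 2≤d bound

  -- `M` has one element more than a vertex; the last summand of `room`, at least one, provides it.
  k<n : suc k ≤ n
  k<n = begin
    suc k                            ≡⟨ +-comm 1 k ⟩
    k + 1                            ≤⟨ +-mono-≤ (m≤m+n k (a * suc (k ∸ a))) (<⇒≤ 2≤d) ⟩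
    k + a * suc (k ∸ a) + (k ∸ a)    ≤⟨ room ⟩
    n                                ∎
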